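{- Let $\Sigma$ be a finite non-empty alphabet. (1) Let $u,w\in\Sigma^*$, let $\ell\in[|u|-1]_0$ and let $v\in\mathrm{CSF}(u,w)$. If $\ell+|v|=|u|$ and $p(u)\le p(w)$, then $u\in\mathrm{JScatFact}(w,\ell)$. (2) For every $w\in\Sigma^*$, every $\ell\in\mathbb N_0$ and every $u\in\mathrm{JScatFact}(w,\ell)$ there exists $v\in\mathrm{CSF}(u,w)$ such that $\ell+|v|=|u|$. (3) For every $w\in\Sigma^*$, every $u\in\mathrm{JScatFact}(w)$ and every $\ell\in\mathbb N$, we have $u\in\overline{\mathrm{JScatFact}}(w,\ell)$ if and only if $\ell=|u|-\mathrm{lcsf}(u,w)$. Thus $\delta_w(u)=|u|-\mathrm{lcsf}(u,w)$.
   Context: $\mathbb N=\{1,2,\dots\}$, $\mathbb N_0=\mathbb N\cup\{0\}$; $[n]=\{1,\dots,n\}$ (empty for $n\le 0$) and $[n]_0=[n]\cup\{0\}$. For a word $w\in\Sigma^*$, $|w|$ is its length and $|w|_a$ the number of occurrences of the letter $a$ in $w$. The Parikh vector of $w$ is $p(w)=(|w|_a)_{a\in\Sigma}$, and $p(u)\le p(w)$ means $|u|_a\le|w|_a$ for all $a\in\Sigma$. A scattered factor of $w$ is a (not necessarily contiguous) subsequence of $w$; $\mathrm{ScatFact}(w)$ is the set of all of them. For $S\subseteq\Sigma^*$, $S_k=S\cap\Sigma^k$. $\mathrm{CSF}(u,w)=\mathrm{ScatFact}(u)\cap\mathrm{ScatFact}(w)$, and $\mathrm{lcsf}(u,w)$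 is the maximal length of an element of $\mathrm{CSF}(u,w)$. $\mathrm{JScatFact}(w)$ is the set of words $u$ for which there is $v\in\mathrm{ScatFact}(w)$ with $p(u)=p(v)$. For $\ell\in\mathbb N_0$, $\mathrm{JScatFact}(w,\ell)$ is the set of words $u$ such that $\ell\in[|u|-1]_0$, $p(u)\le p(w)$, and there exists $v\in\mathrm{ScatFact}_{|u|-\ell}(u)$ with $v\in\mathrm{ScatFact}(w)$. For $u\in\mathrm{JScatFact}(w)$, the jumble index is $\delta_w(u)=\min\{\ell\in\mathbb N_0: u\in\mathrm{JScatFact}(w,\ell)\}$, and $\overline{\mathrm{JScatFact}}(w,\ell)=\{u\in\mathrm{JScatFact}(w,\ell):\delta_w(u)=\ell\}$. -}

module Defs where

open import Data.Fin.Base using (Fin)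
open import Data.Fin.Properties using (all?; eq?)
open import Data.List.Base using (List; []; _∷_; [_]; length; filter)
open import Data.List.Membership.Propositional as Membership using ()
open import Data.List.Properties using (filter-accept)
open import Data.List.Relation.Binary.Sublist.Propositional
  using (_⊆_; []; _∷_; _∷ʳ_; minimum; from∈)
open import Data.List.Relation.Binary.Sublist.Propositional.Properties
  using (length-mono-≤)
import Data.List.Relation.Binary.Sublist.DecPropositional as DecSublist
open import Data.List.Relation.Unary.Any using (here; there)
open import Data.Nat.Base using (ℕ; zero; suc; pred; _∸_; _≤_; _<_; z≤n; s≤s)
open import Data.Nat.Properties as ℕ using (_≤?_)
open import Data.Product.Base using (∃; Σ-syntax; _×_; _,_; proj₁; proj₂)
open import Function.Base using (_∘_)
open import Function.Bundles using (_↔_; module Inverse)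
open import Function.Properties.Inverse using (↔⇒↣)
open import Level using (Level)
open import Relation.Binary.Definitions using (DecidableEquality)
open import Relation.Binary.PropositionalEquality
  using (_≡_; _≗_; refl; sym; trans; cong; subst)
open import Relation.Nullary.Decidable
  using (Dec; yes; no; map′; _×-dec_; _⊎-dec_)
open import Relation.Nullary.Negation using (contradiction)
open import Data.Sum.Base using (_⊎_; inj₁; inj₂)
open import Relation.Unary using (Pred; Decidable; Satisfiable; _∈_; _∩_)

private
  variable
    a p : Level
    A : Set a

IsMinimum IsMaximum : Pred ℕ p → Pred ℕ p
IsMinimum S m = m ∈ S × (∀ {n} → n ∈ S → m ≤ n)
IsMaximum S m = m ∈ S × (∀ {n} → n ∈ S → n ≤ m)

hasMinimum : {S : Pred ℕ p} → Decidable S → ∀ n → n ∈ S → ∃ (IsMinimum S)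
hasMinimum S? zero n∈S = 0 , n∈S , λ _ → z≤n
hasMinimum {S = S} S? (suc n) n∈S with S? 0
... | yes 0∈S = 0 , 0∈S , λ _ → z≤n
... | no  0∉S with hasMinimum (S? ∘ suc) n n∈S
...   | m , m∈S , m≤ = suc m , m∈S , λ {k} → lowerBound k
  where
  lowerBound : ∀ k → S k → suc m ≤ k
  lowerBound zero    0∈S = contradiction 0∈S 0∉S
  lowerBound (suc _) k∈S = s≤s (m≤ k∈S)

hasMaximum : {S : Pred ℕ p} → Decidable S → Satisfiable S →
             ∀ b → (∀ {n} → n ∈ S → n ≤ b) → ∃ (IsMaximum S)
hasMaximum S? (n , n∈S) zero ≤b with z≤n ← ≤b n∈S = 0 , n∈S , ≤b
hasMaximum S? sat (suc b) ≤b with S? (suc b)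
... | yes b∈S = suc b , b∈S , ≤b
... | no  b∉S = hasMaximum S? sat b λ {n} n∈S →
  ℕ.≤-pred (ℕ.≤∧≢⇒< (≤b n∈S) λ { refl → b∉S n∈S })

-- [ n ]₀ = {0, 1, …, n}.  Writing [|u| - 1]₀ as [ length u ∸ 1 ]₀ is correct
-- also for the empty word, because [-1] is empty and so [-1]₀ = {0} = [0]₀.
[_]₀ : ℕ → Pred ℕ _
[ n ]₀ i = i ≤ n

∃⊆? : {P : Pred (List A) p} → Decidable P → ∀ u → Dec (∃ λ v → v ⊆ u × P v)
∃⊆? P? [] = map′ (λ P[] → [] , [] , P[]) (λ { ([] , [] , P[]) → P[] }) (P? [])
∃⊆? {P = P} P? (x ∷ u) = map′ to from
  (∃⊆? P? u ⊎-dec ∃⊆? (P? ∘ (x ∷_)) u)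
  where
  to : (∃ λ v → v ⊆ u × P v) ⊎ (∃ λ v → v ⊆ u × P (x ∷ v)) →
       ∃ λ v → v ⊆ x ∷ u × P v
  to (inj₁ (v , v⊆u , Pv)) = v , x ∷ʳ v⊆u , Pv
  to (inj₂ (v , v⊆u , Pv)) = x ∷ v , refl ∷ v⊆u , Pv

  from : (∃ λ v → v ⊆ x ∷ u × P v) →
         (∃ λ v → v ⊆ u × P v) ⊎ (∃ λ v → v ⊆ u × P (x ∷ v))
  from (v , .x ∷ʳ v⊆u , Pv)      = inj₁ (v , v⊆u , Pv)
  from (.x ∷ v , refl ∷ v⊆u , Pv) = inj₂ (v , v⊆u , Pv)

module ParikhVectors {a} {A : Set a} (_≟_ : DecidableEquality A) where

  parikh : List A → A → ℕ
  parikh w x = length (filter (x ≟_) w)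

  infix 4 _≤ₚ_
  _≤ₚ_ : (f g : A → ℕ) → Set a
  f ≤ₚ g = ∀ x → f x ≤ g x

  parikh-≡ : ∀ {x y} w → x ≡ y → parikh (y ∷ w) x ≡ suc (parikh w x)
  parikh-≡ {x} w x≡y = cong length (filter-accept (x ≟_) x≡y)

  parikh-mono : ∀ {v w} → v ⊆ w → parikh v ≤ₚ parikh w
  parikh-mono [] x = z≤n
  parikh-mono (y ∷ʳ v⊆w) x with x ≟ y
  ... | yes _ = ℕ.m≤n⇒m≤1+n (parikh-mono v⊆w x)
  ... | no  _ = parikh-mono v⊆w x
  parikh-mono (_∷_ {y} refl v⊆w) x with x ≟ y
  ... | yes _ = s≤s (parikh-mono v⊆w x)
  ... | no  _ = parikh-mono v⊆w x

  0<parikh⇒∈ : ∀ {x} w → 0 < parikh w x → x Membership.∈ w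
  0<parikh⇒∈ {x} (y ∷ w) 0< with x ≟ y
  ... | yes x≡y = here x≡y
  ... | no  _   = there (0<parikh⇒∈ w 0<)

  ≤ₚ-realised : ∀ w f → f ≤ₚ parikh w →
                ∃ λ v → v ⊆ w × f ≗ parikh v
  ≤ₚ-realised [] f f≤ = [] , [] , λ x → ℕ.n≤0⇒n≡0 (f≤ x)
  ≤ₚ-realised (y ∷ w) f f≤ with f y in fy≡
  ... | zero = let v , v⊆w , f≗ = ≤ₚ-realised w f f≤′ in v , y ∷ʳ v⊆w , f≗
    where
    f≤′ : f ≤ₚ parikh w
    f≤′ x with x ≟ y | f≤ x
    ... | yes refl | _  = subst (_≤ parikh w x) (sym fy≡) z≤n
    ... | no  _    | h = h
  ... | suc n = let v , v⊆w , g≗ = ≤ₚ-realised w g g≤ in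
                y ∷ v , refl ∷ v⊆w , f≗ v g≗
    where
    g : A → ℕ
    g x with x ≟ y
    ... | yes _ = pred (f x)
    ... | no  _ = f x

    g≤ : g ≤ₚ parikh w
    g≤ x with x ≟ y | f≤ x
    ... | yes _ | h = ℕ.pred-mono-≤ h
    ... | no  _ | h = h

    f≗ : ∀ v → g ≗ parikh v → f ≗ parikh (y ∷ v)
    f≗ v g≗ x with x ≟ y | g≗ x
    ... | yes refl | h = trans fy≡ (cong suc (trans (cong pred (sym fy≡)) h))
    ... | no  _    | h = h

module Words {a} {A : Set a} {k : ℕ} (finite : A ↔ Fin (suc k)) where

  _≟_ : DecidableEquality A
  _≟_ = eq? (↔⇒↣ finite)

  open DecSublist _≟_ using (_⊆?_)
  open ParikhVectors _≟_ public

  Word : Set a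
  Word = List A

  infix 8 _∩Σ^_
  _∩Σ^_ : Pred Word a → ℕ → Pred Word a
  S ∩Σ^ n = S ∩ λ w → length w ≡ n

  ScatFact : Word → Pred Word a
  ScatFact w v = v ⊆ w

  CSF : Word → Word → Pred Word a
  CSF u w = ScatFact u ∩ ScatFact w

  CSFLength : Word → Word → Pred ℕ a
  CSFLength u w n = ∃ λ v → v ∈ CSF u w × length v ≡ n

  CSFLength-hasMaximum : ∀ u w → ∃ (IsMaximum (CSFLength u w))
  CSFLength-hasMaximum u w = hasMaximum
    (λ n → map′ (λ (v , v⊆u , v⊆w , eq) → v , (v⊆u , v⊆w) , eq)
                (λ (v , (v⊆u , v⊆w) , eq) → v , v⊆u , v⊆w , eq)
                (∃⊆? (λ v → (v ⊆? w) ×-dec (length v ℕ.≟ n)) u))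
    (0 , [] , (minimum u , minimum w) , refl)
    (length u)
    λ { (_ , (v⊆u , _) , refl) → length-mono-≤ v⊆u }

  lcsf : Word → Word → ℕ
  lcsf u w = proj₁ (CSFLength-hasMaximum u w)

  JScatFact : Word → Pred Word a
  JScatFact w u = ∃ λ v → v ∈ ScatFact w × parikh u ≗ parikh v

  -- The subtraction is exact, as ℓ ∈ [ length u ∸ 1 ]₀ implies ℓ ≤ length u.
  JScatFact[_,_] : Word → ℕ → Pred Word a
  JScatFact[ w , ℓ ] u =
    ℓ ∈ [ length u ∸ 1 ]₀ ×
    parikh u ≤ₚ parikh w ×
    ∃ λ v → v ∈ ScatFact u ∩Σ^ (length u ∸ ℓ) × v ∈ ScatFact w

  JScatFact[,]? : ∀ w u → Decidable (λ ℓ → u ∈ JScatFact[ w , ℓ ])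
  JScatFact[,]? w u ℓ =
    (ℓ ≤? length u ∸ 1) ×-dec ≤ₚ? ×-dec
    map′ (λ (v , v⊆u , eq , v⊆w) → v , (v⊆u , eq) , v⊆w)
         (λ (v , (v⊆u , eq) , v⊆w) → v , v⊆u , eq , v⊆w)
         (∃⊆? (λ v → (length v ℕ.≟ length u ∸ ℓ) ×-dec (v ⊆? w)) u)
    where
    open Inverse finite using (to; from; strictlyInverseʳ)

    ≤ₚ? : Dec (parikh u ≤ₚ parikh w)
    ≤ₚ? = map′
      (λ h x → subst (λ y → parikh u y ≤ parikh w y) (strictlyInverseʳ x) (h (to x)))
      (λ h i → h (from i))
      (all? λ i → parikh u (from i) ≤? parikh w (from i))

  JScatFact[,]⇒JScatFact : ∀ {w ℓ u} → u ∈ JScatFact[ w , ℓ ] → u ∈ JScatFact w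
  JScatFact[,]⇒JScatFact {w} {u = u} (_ , pu≤pw , _) =
    ≤ₚ-realised w (parikh u) pu≤pw

  JScatFact⇒JScatFact[,] : ∀ {w u} → u ∈ JScatFact w →
                           ∃ λ ℓ → u ∈ JScatFact[ w , ℓ ]
  JScatFact⇒JScatFact[,] {w} {[]} _ =
    0 , z≤n , (λ _ → z≤n) , [] , ([] , refl) , minimum w
  JScatFact⇒JScatFact[,] {w} {x ∷ u} (v , v⊆w , pu≗pv) =
    length u , ℕ.≤-refl , pu≤pw ,
    [ x ] , (refl ∷ minimum u , sym (ℕ.m+n∸n≡m 1 (length u))) ,
    from∈ (0<parikh⇒∈ w (ℕ.≤-trans 0<px (pu≤pw x)))
    where
    pu≤pw : parikh (x ∷ u) ≤ₚ parikh w
    pu≤pw y = subst (_≤ parikh w y) (sym (pu≗pv y)) (parikh-mono v⊆w y)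

    0<px : 0 < parikh (x ∷ u) x
    0<px = subst (0 <_) (sym (parikh-≡ u refl)) (s≤s z≤n)

  jumbleIndex-exists : ∀ w u → u ∈ JScatFact w →
                       ∃ (IsMinimum (λ ℓ → u ∈ JScatFact[ w , ℓ ]))
  jumbleIndex-exists w u u∈J =
    let ℓ , u∈J[w,ℓ] = JScatFact⇒JScatFact[,] u∈J
    in hasMinimum (JScatFact[,]? w u) ℓ u∈J[w,ℓ]

  -- The jumble index δ_w(u), defined only for u ∈ JScatFact w; its value does
  -- not depend on the membership proof, since minima are unique.
  δ : ∀ w u → u ∈ JScatFact w → ℕ
  δ w u u∈J = proj₁ (jumbleIndex-exists w u u∈J)

  JScatFact‾[_,_] : Word → ℕ → Pred Word a
  JScatFact‾[ w , ℓ ] u =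
    Σ[ u∈J ∈ u ∈ JScatFact[ w , ℓ ] ] δ w u (JScatFact[,]⇒JScatFact u∈J) ≡ ℓ

{-# OPTIONS --safe #-}
module Submission where

open import Defs
open import Data.Fin.Base using (Fin)
open import Data.List.Base using (length)
open import Data.List.Relation.Binary.Sublist.Propositional.Properties
  using (length-mono-≤)
open import Data.Nat.Base using (ℕ; suc; _+_; _∸_; _≤_)
open import Data.Nat.Properties
  using (≤-trans; ≤-antisym; m+n∸m≡n; m+n∸n≡m; m+[n∸m]≡n; m∸n+n≡m; m∸n≤m; ∸-monoʳ-≤)
open import Data.Product.Base using (∃; _×_; _,_; proj₁; proj₂)
open import Function.Bundles using (_↔_; _⇔_; mk⇔)
open import Relation.Binary.PropositionalEquality
  using (_≡_; refl; sym; trans; cong; subst)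
open import Relation.Unary using (_∈_)

-- The index `ℓ` counts the letters of `u` left out by a common scattered factor with `w`: under the
-- bound on `ℓ` and the Parikh condition, `u ∈ JScatFact[ w , ℓ ]` amounts to having such a factor
-- of length `length u ∸ ℓ`. Minimising `ℓ` thus means maximising that length: `length∸lcsf≤` bounds
-- every admissible `ℓ` from below, and `JScatFact[,length∸lcsf]` attains the bound.

module _ {a} {A : Set a} {k : ℕ} (finite : A ↔ Fin (suc k)) where
  open Words finite

  CSF⇒JScatFact[,] : ∀ {u w ℓ v} → ℓ ∈ [ length u ∸ 1 ]₀ → v ∈ CSF u w →
                     ℓ + length v ≡ length u → parikh u ≤ₚ parikh w →
                     u ∈ JScatFact[ w , ℓ ]
  CSF⇒JScatFact[,] {ℓ = ℓ} {v} ℓ≤ (v⊆u , v⊆w) eq pu≤pw =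
    ℓ≤ , pu≤pw , v ,
    (v⊆u , trans (sym (m+n∸m≡n ℓ (length v))) (cong (_∸ ℓ) eq)) , v⊆w

  JScatFact[,]⇒CSF : ∀ {w ℓ u} → u ∈ JScatFact[ w , ℓ ] →
                     ∃ λ v → v ∈ CSF u w × ℓ + length v ≡ length u
  JScatFact[,]⇒CSF {ℓ = ℓ} {u} (ℓ≤ , _ , v , (v⊆u , eq) , v⊆w) =
    v , (v⊆u , v⊆w) ,
    -- Truncated subtraction is exact here, as `ℓ ≤ length u ∸ 1 ≤ length u`.
    trans (cong (ℓ +_) eq) (m+[n∸m]≡n (≤-trans ℓ≤ (m∸n≤m (length u) 1)))

  length≤lcsf : ∀ {u w v} → v ∈ CSF u w → length v ≤ lcsf u w
  length≤lcsf {u} {w} {v} v∈ = proj₂ (proj₂ (CSFLength-hasMaximum u w)) (v , v∈ , refl)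

  length∸lcsf≤ : ∀ {w ℓ u} → u ∈ JScatFact[ w , ℓ ] → length u ∸ lcsf u w ≤ ℓ
  length∸lcsf≤ {w} {ℓ} {u} u∈ =
    let v , v∈ , eq = JScatFact[,]⇒CSF u∈
    in subst (length u ∸ lcsf u w ≤_)
         (trans (cong (_∸ length v) (sym eq)) (m+n∸n≡m ℓ (length v)))
         (∸-monoʳ-≤ (length u) (length≤lcsf v∈))

  -- A longest common scattered factor leaves out at most as many letters as any
  -- other, so the bound ℓ ≤ |u| - 1 is inherited from the given ℓ.
  JScatFact[,length∸lcsf] : ∀ {w ℓ u} → u ∈ JScatFact[ w , ℓ ] →
                            u ∈ JScatFact[ w , length u ∸ lcsf u w ]
  JScatFact[,length∸lcsf] {w} {u = u} u∈@(ℓ≤ , pu≤pw , _)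
    with m , (v , v∈@(v⊆u , _) , refl) , _ ← CSFLength-hasMaximum u w
       | ≤ℓ ← length∸lcsf≤ u∈ =
    CSF⇒JScatFact[,] (≤-trans ≤ℓ ℓ≤) v∈ (m∸n+n≡m (length-mono-≤ v⊆u)) pu≤pw

  -- Holds for an arbitrary proof `u∈J`, because `JScatFact‾[ w , ℓ ]` evaluates `δ` at a proof
  -- rebuilt from membership in `JScatFact[ w , ℓ ]`.
  δ≡length∸lcsf : ∀ w u (u∈J : u ∈ JScatFact w) → δ w u u∈J ≡ length u ∸ lcsf u w
  δ≡length∸lcsf w u u∈J =
    let _ , u∈ , δ≤ = jumbleIndex-exists w u u∈J
    in ≤-antisym (δ≤ (JScatFact[,length∸lcsf] u∈)) (length∸lcsf≤ u∈)

  JScatFact‾⇔length∸lcsf : ∀ w u {ℓ} → u ∈ JScatFact w →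
                           u ∈ JScatFact‾[ w , ℓ ] ⇔ ℓ ≡ length u ∸ lcsf u w
  JScatFact‾⇔length∸lcsf w u u∈J = mk⇔
    (λ (u∈ , δ≡ℓ) → trans (sym δ≡ℓ) (δ≡length∸lcsf w u (JScatFact[,]⇒JScatFact {u = u} u∈)))
    λ { refl →
      -- Some admissible index suffices; for nonempty `u` it is `length u ∸ 1`, witnessed by a
      -- single shared letter.
      let u∈ = JScatFact[,length∸lcsf] (proj₂ (JScatFact⇒JScatFact[,] u∈J))
      in u∈ , δ≡length∸lcsf w u (JScatFact[,]⇒JScatFact {u = u} u∈) }

lemma9 : ∀ {a} {A : Set a} {k : ℕ} (finite : A ↔ Fin (suc k)) →
    let open Words finite in
    (∀ (u w : Word) (ℓ : ℕ) → ℓ ∈ [ length u ∸ 1 ]₀ →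
    ∀ (v : Word) → v ∈ CSF u w →
    ℓ + length v ≡ length u → parikh u ≤ₚ parikh w →
    u ∈ JScatFact[ w , ℓ ])
    ×
    (∀ (w : Word) (ℓ : ℕ) (u : Word) → u ∈ JScatFact[ w , ℓ ] →
    ∃ λ (v : Word) → v ∈ CSF u w × ℓ + length v ≡ length u)
    ×
    (∀ (w u : Word) (u∈J : u ∈ JScatFact w) →
    (∀ (ℓ : ℕ) → 1 ≤ ℓ →
    u ∈ JScatFact‾[ w , ℓ ] ⇔ ℓ ≡ length u ∸ lcsf u w)
    ×
    δ w u u∈J ≡ length u ∸ lcsf u w)
lemma9 finite =
  (λ _ _ _ ℓ≤ _ → CSF⇒JScatFact[,] finite ℓ≤) ,
  (λ _ _ _ → JScatFact[,]⇒CSF finite) ,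
  λ w u u∈J → (λ _ _ → JScatFact‾⇔length∸lcsf finite w u u∈J) , δ≡length∸lcsf finite w u u∈J
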